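{- Let $n\ge 3$ and let $S\subseteq\mathbb{Z}_n\setminus\{0\}$ with $S=-S$. The circulant graph $\mathrm{Cay}(\mathbb{Z}_n,S)$ is $\mathbb{Z}_n$-distance antimagic if one of the following holds: (a) $n$ is even, $n/2\in S$, and, writing elements of $S$ as integers in $\{1,\ldots,n-1\}$, $S\setminus\{n/2\}$ contains exactly $2s$ even integers and $2t$ odd integers, where both $2(s-t)+1$ and $2(t-s)+1$ are coprime to $n$; (b) $\gcd(|S|,n)=1$. Moreover, if $|S|$ and $n$ are both even, then $\mathrm{Cay}(\mathbb{Z}_n,S)$ is not $\mathbb{Z}_n$-distance antimagic.
   Context: $\mathrm{Cay}(\mathbb{Z}_n,S)$ has vertex set $\mathbb{Z}_n$, with $x,y$ adjacent iff $x-y\in S$ (mod $n$). For a graph $G$ with $n$ vertices, a $\mathbb{Z}_n$-distance antimagic labelling is a bijection $f:V(G)\to\mathbb{Z}_n$ such that the weights $w_f(x)=\sum_{y\in N(x)} f(y)$ (mod $n$, $N(x)$ the open neighbourhood) are pairwise distinct; $G$ is $\mathbb{Z}_n$-distance antimagic if such a labelling exists. -}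

module Defs where

open import Data.Bool.Base using (if_then_else_)
open import Data.Fin.Base using (Fin; toℕ)
open import Data.Fin.Properties using (toℕ-injective; toℕ-fromℕ<; toℕ≤n)
open import Data.Fin.Subset using (Subset; _∈_; _∉_; ∁)
open import Data.Fin.Subset.Properties using (_∈?_)
open import Data.Nat.Base using (ℕ; suc; _+_; _*_; _∸_; NonZero)
open import Data.Nat.Divisibility using (_∣?_)
open import Data.Nat.DivMod
open import Data.Nat.Properties
open import Data.Nat.Solver using (module +-*-Solver)
open import Data.Product.Base using (∃; _×_)
open import Data.Vec.Base using (tabulate)
open import Function.Bundles using (_⇔_; module Equivalence)
open import Function.Definitions using (Injective; Bijective)
open import Relation.Binary.Core using (Rel)
open import Relation.Binary.Definitions using (Symmetric; Decidable)
open import Relation.Binary.PropositionalEquality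
open import Relation.Nullary using (¬_; does)
open import Level using (0ℓ)
open import Algebra.Properties.CommutativeMonoid.Sum +-0-commutativeMonoid using (sum)

-- Finite simple graphs, with vertex set Fin n.

record Graph (n : ℕ) : Set₁ where
  field
    Adj    : Rel (Fin n) 0ℓ
    adj?   : Decidable Adj
    symm   : Symmetric Adj
    noLoop : ∀ x → ¬ Adj x x

-- Labels live in ℤₙ, represented by Fin n with the residues 0, …, n-1.
-- The sum is over all vertices y, with non-neighbours of x contributing 0;
-- it is taken in ℕ and then reduced mod n.

weight : ∀ {n} .{{_ : NonZero n}} → Graph n → (Fin n → Fin n) → Fin n → Fin n
weight {n} G f x =
  sum (λ y → if does (adj? x y) then toℕ (f y) else 0) mod n
  where open Graph G

ℤₙ-DistanceAntimagic : ∀ {n} .{{_ : NonZero n}} → Graph n → Set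
ℤₙ-DistanceAntimagic {n} G =
  ∃ λ (f : Fin n → Fin n) → Bijective _≡_ _≡_ f × Injective _≡_ _≡_ (weight G f)

module _ {n : ℕ} .{{_ : NonZero n}} where

  infixl 6 _⊖_
  infix  8 ⊖_

  0ₙ : Fin n
  0ₙ = 0 mod n

  ⊖_ : Fin n → Fin n
  ⊖ x = (n ∸ toℕ x) mod n

  _⊖_ : Fin n → Fin n → Fin n
  x ⊖ y = (toℕ x + (n ∸ toℕ y)) mod n

  -- S = -S, where x ∈ -S means -x ∈ S.

  NegationInvariant : Subset n → Set
  NegationInvariant S = ∀ x → x ∈ S ⇔ ⊖ x ∈ S

  private
    toℕ-mod : ∀ m → toℕ (m mod n) ≡ m % n
    toℕ-mod m = toℕ-fromℕ< (m%n<n m n)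

    mod-cong : ∀ {a b} → a % n ≡ b % n → a mod n ≡ b mod n
    mod-cong {a} {b} eq = toℕ-injective (trans (toℕ-mod a) (trans eq (sym (toℕ-mod b))))

  x⊖x≡0 : ∀ x → x ⊖ x ≡ 0ₙ
  x⊖x≡0 x = mod-cong (begin
    (toℕ x + (n ∸ toℕ x)) % n  ≡⟨ cong (_% n) (m+[n∸m]≡n (toℕ≤n x)) ⟩
    n % n                      ≡⟨ n%n≡0 n ⟩
    0                          ≡⟨ m*n%n≡0 0 n ⟨
    0 % n                      ∎)
    where open ≡-Reasoning

  ⊖-antisym : ∀ x y → ⊖ (x ⊖ y) ≡ y ⊖ x
  ⊖-antisym x y = mod-cong (begin
    (n ∸ toℕ (x ⊖ y)) % n      ≡⟨ cong (λ k → (n ∸ k) % n) (toℕ-mod a) ⟩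
    (n ∸ r) % n                ≡⟨ [m+kn]%n≡m%n (n ∸ r) 2 n ⟨
    ((n ∸ r) + 2 * n) % n      ≡⟨ cong (_% n) shift ⟨
    (b + suc q * n) % n        ≡⟨ [m+kn]%n≡m%n b (suc q) n ⟩
    b % n                      ∎)
    where
    open ≡-Reasoning
    open +-*-Solver
    x′ = n ∸ toℕ x
    y′ = n ∸ toℕ y
    a = toℕ x + y′
    b = toℕ y + x′
    r = a % n
    q = a / n

    a+b≡2n : a + b ≡ 2 * n
    a+b≡2n = begin
      a + b
        ≡⟨ solve 4 (λ s t u v → s :+ v :+ (t :+ u) := (s :+ u) :+ (t :+ v)) refl (toℕ x) (toℕ y) x′ y′ ⟩
      (toℕ x + x′) + (toℕ y + y′)
        ≡⟨ cong₂ _+_ (m+[n∸m]≡n (toℕ≤n x)) (m+[n∸m]≡n (toℕ≤n y)) ⟩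
      n + n
        ≡⟨ cong (n +_) (+-identityʳ n) ⟨
      2 * n ∎

    shift : b + suc q * n ≡ (n ∸ r) + 2 * n
    shift = begin
      b + (n + q * n)
        ≡⟨ cong (λ k → b + (k + q * n)) (m∸n+n≡m (<⇒≤ (m%n<n a n))) ⟨
      b + ((n ∸ r + r) + q * n)
        ≡⟨ solve 4 (λ s t u v → s :+ ((t :+ u) :+ v) := t :+ ((u :+ v) :+ s)) refl b (n ∸ r) r (q * n) ⟩
      (n ∸ r) + ((r + q * n) + b)
        ≡⟨ cong (λ k → (n ∸ r) + (k + b)) (m≡m%n+[m/n]*n a n) ⟨
      (n ∸ r) + (a + b)
        ≡⟨ cong ((n ∸ r) +_) a+b≡2n ⟩
      (n ∸ r) + 2 * n ∎

  Cay : (S : Subset n) → 0ₙ ∉ S → NegationInvariant S → Graph n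
  Cay S 0∉S S=-S = record
    { Adj    = λ x y → x ⊖ y ∈ S
    ; adj?   = λ x y → x ⊖ y ∈? S
    ; symm   = λ {x} {y} x-y∈S →
        subst (_∈ S) (⊖-antisym x y) (Equivalence.to (S=-S (x ⊖ y)) x-y∈S)
    ; noLoop = λ x x-x∈S → 0∉S (subst (_∈ S) (x⊖x≡0 x) x-x∈S)
    }

-- Parity of an element of ℤₙ means parity of its representative in
-- {0, …, n-1}.

evens odds : ∀ {n} → Subset n
evens = tabulate (λ x → does (2 ∣? toℕ x))
odds  = ∁ evens

{-# OPTIONS --safe #-}

-- Let ε : ℤₙ → {±1} satisfy ε(x - y) = ε(x) ε(y): take ε = 1 in case (b), and
-- ε(x) = (-1)^x in case (a), where n is even.  Label x by ε(x) x.  Then x has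
-- weight ε(x) (k x - c), with k = Σ_{s∈S} ε(s) and c = Σ_{s∈S} ε(s) s.  The
-- hypotheses say that k is coprime to n: in case (b) it is |S|, in case (a) it
-- is 2(s - t) ± 1, the sign being that of n/2.  For even n the weight then has
-- the parity of x - c, so equal weights force equal signs ε, and cancelling k
-- shows that weights are distinct; the same argument with k = 1 and c = 0 shows
-- that labels are.
--
-- If |S| and n are even, bijective weights would sum to n(n - 1)/2, but each
-- label occurs in |S| weights, so they also sum to |S| n(n - 1)/2 mod n.  Hence
-- (n - 1)(1 - |S|) would be even.

module Submission where

open import Defs
open import Data.Bool.Base using (Bool; true; false; if_then_else_; not; _∧_)
open import Data.Empty using (⊥-elim)
open import Data.Fin.Base using (Fin; zero; suc; toℕ; fromℕ<; punchOut)
open import Data.Fin.Permutation using (permutation)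
open import Data.Fin.Properties
  using (_≟_; any?; toℕ<n; toℕ≤n; toℕ-fromℕ<; toℕ-injective; punchOut-injective; injective⇒≤)
open import Data.Fin.Subset.Properties using (_∈?_; p─⊥≡p)
open import Data.Integer.Base as ℤ using (ℤ; 0ℤ; 1ℤ; -1ℤ)
open import Data.Integer.Coprimality using (coprime-divisor)
import Data.Integer.Divisibility.Signed as ℤ∣
import Data.Integer.DivMod as ℤ
import Data.Integer.Properties as ℤ
open import Data.Integer.Tactic.RingSolver using (solve-∀)
import Data.Nat.Base as ℕ
open import Data.Nat.Coprimality using (gcd≡1⇒coprime)
import Data.Nat.DivMod as ℕ
import Data.Nat.Divisibility as ℕ
import Data.Nat.Properties as ℕ
open import Data.Product.Base using (_,_; proj₁; proj₂)
open import Data.Sum.Base using ([_,_]′)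
open import Data.Vec.Base using (_∷_; []; lookup; here; there)
open import Data.Vec.Properties using (lookup-zipWith; lookup-map; lookup∘tabulate)
open import Function.Base using (_∘_; id)
open import Function.Consequences.Propositional using (strictlySurjective⇒surjective)
open import Function.Definitions using (Injective; Bijective; StrictlySurjective)
open import Relation.Binary.Bundles using (Setoid)
import Relation.Binary.Reasoning.Setoid as SetoidReasoning
open import Relation.Binary.PropositionalEquality
  using (refl; sym; trans; cong; cong₂; subst; module ≡-Reasoning)
open import Relation.Nullary using (Dec; yes; no; does)
open import Algebra.Properties.Semiring.Sum ℤ.+-*-semiring
  using (sum; sum-cong-≗; ∑-distrib-+; ∑-comm; sum-permute; *-distribˡ-sum; *-distribʳ-sum)
open import Algebra.Properties.CommutativeMonoid.Sum ℕ.+-0-commutativeMonoid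
  using () renaming (sum to sumℕ)
open import Data.Nat.Base using (ℕ; _*_; _/_; _≥_; NonZero)
open import Data.Nat.Divisibility using (_∣_)
open import Data.Nat.DivMod using (_mod_)
open import Data.Nat.GCD using (gcd)
open import Data.Integer.Base as ℤ using (+_)
open import Data.Integer.Coprimality using (Coprime)
open import Data.Fin.Subset using (Subset; _∈_; _∉_; _∩_; _-_; ∣_∣)
open import Data.Product.Base using (∃₂; _×_)
open import Data.Sum.Base using (_⊎_)
open import Relation.Binary.PropositionalEquality using (_≡_)
open import Relation.Nullary using (¬_)

private variable
  m n : ℕ

-- Maps between finite sets

-- Pigeonhole: if `y` were missed, punching it out of the codomain would inject `suc n` points into
-- `n`.
injective⇒strictlySurjective : {f : Fin n → Fin n} → Injective _≡_ _≡_ f → StrictlySurjective _≡_ f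
injective⇒strictlySurjective {n = ℕ.suc n} {f} inj y with any? (λ x → f x ≟ y)
... | yes p = p
... | no ¬p = ⊥-elim (ℕ.1+n≰n (injective⇒≤ {f = λ x → punchOut (y≢f x)} λ eq →
        inj (punchOut-injective (y≢f _) (y≢f _) eq)))
  where
  y≢f : ∀ x → ¬ y ≡ f x
  y≢f x eq = ¬p (x , sym eq)

injective⇒bijective : {f : Fin n → Fin n} → Injective _≡_ _≡_ f → Bijective _≡_ _≡_ f
injective⇒bijective inj = inj , strictlySurjective⇒surjective (injective⇒strictlySurjective inj)

-- The preimages supplied by surjectivity form a right inverse of `σ`, and injectivity makes it
-- two-sided, so `σ` is a permutation.
sum-reindex : {σ : Fin n → Fin n} → Injective _≡_ _≡_ σ → (g : Fin n → ℤ) → sum (g ∘ σ) ≡ sum g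
sum-reindex {σ = σ} inj g = sym (sum-permute g (permutation σ σ⁻¹ σσ⁻¹ (λ x → inj (σσ⁻¹ (σ x)))))
  where
  σ⁻¹ = proj₁ ∘ injective⇒strictlySurjective inj
  σσ⁻¹ = proj₂ ∘ injective⇒strictlySurjective inj

-- Sums over subsets

pos-sum : (g : Fin n → ℕ) → + sumℕ g ≡ sum (λ i → + g i)
pos-sum {ℕ.zero}  g = refl
pos-sum {ℕ.suc n} g = trans (ℤ.pos-+ (g zero) _) (cong (λ z → + g zero ℤ.+ z) (pos-sum (g ∘ suc)))

𝟙 : Bool → ℤ
𝟙 b = if b then 1ℤ else 0ℤ

sumOver : Subset n → (Fin n → ℤ) → ℤ
sumOver S g = sum (λ i → 𝟙 (lookup S i) ℤ.* g i)

-- Bridges the membership test in the adjacency of `Cay` and the Boolean entries used by `sumOver`.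
does-∈? : (i : Fin n) (S : Subset n) → does (i ∈? S) ≡ lookup S i
does-∈? zero    (true  ∷ S) = refl
does-∈? zero    (false ∷ S) = refl
does-∈? (suc i) (_ ∷ S)     = does-∈? i S

sumOver-1 : (S : Subset n) → sumOver S (λ _ → 1ℤ) ≡ + ∣ S ∣
sumOver-1 []          = refl
sumOver-1 (true  ∷ S) = cong (λ z → 1ℤ ℤ.+ z) (sumOver-1 S)
sumOver-1 (false ∷ S) = trans (ℤ.+-identityˡ _) (sumOver-1 S)

-- Isolates the term of n/2 in case (a), where the parity counts concern only the remaining
-- elements.
sumOver-remove : {S : Subset n} {p : Fin n} → p ∈ S → (g : Fin n → ℤ) →
                 sumOver S g ≡ g p ℤ.+ sumOver (S - p) g
sumOver-remove {S = _ ∷ S} here g = begin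
  1ℤ ℤ.* g zero ℤ.+ r
    ≡⟨ lem (g zero) r ⟩
  g zero ℤ.+ (0ℤ ℤ.* g zero ℤ.+ r)
    -- Removing `zero` clears the head and takes the empty set away from the tail, so the tail
    -- equals `S` only up to a proof.
    ≡⟨ cong (λ T → g zero ℤ.+ (0ℤ ℤ.* g zero ℤ.+ sumOver T (g ∘ suc))) (p─⊥≡p S) ⟨
  g zero ℤ.+ sumOver ((true ∷ S) - zero) g ∎
  where
  open ≡-Reasoning
  r = sumOver S (g ∘ suc)
  lem : ∀ a r → 1ℤ ℤ.* a ℤ.+ r ≡ a ℤ.+ (0ℤ ℤ.* a ℤ.+ r)
  lem = solve-∀
sumOver-remove {S = b ∷ S} {suc p} (there p∈S) g = begin
  h ℤ.+ sumOver S (g ∘ suc)                             ≡⟨ cong (λ z → h ℤ.+ z) (sumOver-remove p∈S (g ∘ suc)) ⟩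
  h ℤ.+ (g (suc p) ℤ.+ sumOver (S - p) (g ∘ suc))       ≡⟨ lem h (g (suc p)) _ ⟩
  g (suc p) ℤ.+ (h ℤ.+ sumOver (S - p) (g ∘ suc))       ∎
  where
  open ≡-Reasoning
  h = 𝟙 b ℤ.* g zero
  lem : ∀ a b c → a ℤ.+ (b ℤ.+ c) ≡ b ℤ.+ (a ℤ.+ c)
  lem = solve-∀

-- Congruences between integers

infix 4 _≡_[mod_]
-- A record rather than a bare divisibility, so that both sides can be inferred from the type, which
-- the difference alone does not determine.
record _≡_[mod_] (i j : ℤ) (m : ℕ) : Set where
  constructor congruent
  field divides-difference : + m ℤ∣.∣ i ℤ.- j

≡mod-reflexive : ∀ {i j} → i ≡ j → i ≡ j [mod m ]
≡mod-reflexive {i = i} refl = congruent (ℤ∣.divides 0ℤ (ℤ.+-inverseʳ i))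

≡mod-setoid : ℕ → Setoid _ _
≡mod-setoid m = record
  { Carrier       = ℤ
  ; _≈_           = _≡_[mod m ]
  ; isEquivalence = record
    { refl  = ≡mod-reflexive refl
    ; sym   = λ {i} {j} (congruent d) →
        congruent (subst (+ m ℤ∣.∣_) (negate i j) (ℤ∣.∣m⇒∣-m d))
    ; trans = λ {i} {j} {k} (congruent d) (congruent e) →
        congruent (subst (+ m ℤ∣.∣_) (telescope i j k) (ℤ∣.∣m∣n⇒∣m+n d e))
    }
  }
  where
  negate : ∀ i j → ℤ.- (i ℤ.- j) ≡ j ℤ.- i
  negate = solve-∀
  telescope : ∀ i j k → i ℤ.- j ℤ.+ (j ℤ.- k) ≡ i ℤ.- k
  telescope = solve-∀

module ≡mod {m : ℕ} = Setoid (≡mod-setoid m)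

≡mod-+-cong : ∀ {i i′ j j′} → i ≡ i′ [mod m ] → j ≡ j′ [mod m ] → i ℤ.+ j ≡ i′ ℤ.+ j′ [mod m ]
≡mod-+-cong {i = i} {i′} {j} {j′} (congruent d) (congruent e) =
  congruent (subst (_ ℤ∣.∣_) (lem i i′ j j′) (ℤ∣.∣m∣n⇒∣m+n d e))
  where
  lem : ∀ i i′ j j′ → i ℤ.- i′ ℤ.+ (j ℤ.- j′) ≡ i ℤ.+ j ℤ.- (i′ ℤ.+ j′)
  lem = solve-∀

≡mod-*-congˡ : ∀ k {i j} → i ≡ j [mod m ] → k ℤ.* i ≡ k ℤ.* j [mod m ]
≡mod-*-congˡ k {i} {j} (congruent d) =
  congruent (subst (_ ℤ∣.∣_) (lem k i j) (ℤ∣.∣n⇒∣m*n k d))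
  where
  lem : ∀ k i j → k ℤ.* (i ℤ.- j) ≡ k ℤ.* i ℤ.- k ℤ.* j
  lem = solve-∀

-- Euclid's lemma: `m` divides k(i - j) and is coprime to `k`, so it divides i - j.
≡mod-*-cancelˡ : ∀ k {i j} → Coprime k (+ m) → k ℤ.* i ≡ k ℤ.* j [mod m ] → i ≡ j [mod m ]
≡mod-*-cancelˡ {m} k {i} {j} c (congruent d) =
  congruent (ℤ∣.∣ᵤ⇒∣ (coprime-divisor (+ m) k (i ℤ.- j) (λ (p , q) → c (q , p))
    (ℤ∣.∣⇒∣ᵤ (subst (+ m ℤ∣.∣_) (lem k i j) d))))
  where
  lem : ∀ k i j → k ℤ.* i ℤ.- k ℤ.* j ≡ k ℤ.* (i ℤ.- j)
  lem = solve-∀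

≡mod-+-cancelʳ : ∀ k {i j} → i ℤ.+ k ≡ j ℤ.+ k [mod m ] → i ≡ j [mod m ]
≡mod-+-cancelʳ k {i} {j} (congruent d) = congruent (subst (_ ℤ∣.∣_) (lem k i j) d)
  where
  lem : ∀ k i j → i ℤ.+ k ℤ.- (j ℤ.+ k) ≡ i ℤ.- j
  lem = solve-∀

≡mod-sum : {g h : Fin n → ℤ} → (∀ i → g i ≡ h i [mod m ]) → sum g ≡ sum h [mod m ]
≡mod-sum {ℕ.zero}  eq = ≡mod.refl
≡mod-sum {ℕ.suc n} eq = ≡mod-+-cong (eq zero) (≡mod-sum (eq ∘ suc))

≡mod-∣ : ∀ {d i j} → d ∣ m → i ≡ j [mod m ] → i ≡ j [mod d ]
≡mod-∣ d∣m (congruent e) = congruent (ℤ∣.∣-trans (ℤ∣.∣ᵤ⇒∣ d∣m) e)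

-- Residues modulo n

-- Two representatives differ by less than `n` in absolute value, and the only such multiple of `n`
-- is 0.
toℕ-≡mod-injective : {x y : Fin n} → + toℕ x ≡ + toℕ y [mod n ] → x ≡ y
toℕ-≡mod-injective {n} {x} {y} (congruent d) = toℕ-injective (ℤ.+-injective
  (ℤ.i-j≡0⇒i≡j (+ toℕ x) (+ toℕ y) (ℤ.∣i∣≡0⇒i≡0 (vanish _ (ℤ∣.∣⇒∣ᵤ d) small))))
  where
  vanish : ∀ a → n ∣ a → a ℕ.< n → a ≡ 0
  vanish ℕ.zero    _   _   = refl
  vanish (ℕ.suc a) n∣a a<n = ⊥-elim (ℕ.>⇒∤ a<n n∣a)

  small : ℤ.∣ + toℕ x ℤ.- + toℕ y ∣ ℕ.< n
  small rewrite ℤ.m-n≡m⊖n (toℕ x) (toℕ y) =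
    ℕ.≤-<-trans (ℤ.∣m⊝n∣≤m⊔n (toℕ x) (toℕ y)) (ℕ.⊔-lub (toℕ<n x) (toℕ<n y))

module _ {n : ℕ} .{{_ : NonZero n}} where

  toℕ-mod : ∀ a → + toℕ (a mod n) ≡ + a [mod n ]
  toℕ-mod a rewrite toℕ-fromℕ< (ℕ.m%n<n a n) = ≡mod.sym
    (congruent (ℤ∣.divides (+ (a / n)) (begin
      + a ℤ.- + (a ℕ.% n)
        ≡⟨ cong (λ b → + b ℤ.- + (a ℕ.% n)) (ℕ.m≡m%n+[m/n]*n a n) ⟩
      + (a ℕ.% n ℕ.+ (a / n) * n) ℤ.- + (a ℕ.% n)
        ≡⟨ cong (ℤ._- (+ (a ℕ.% n))) (ℤ.pos-+ (a ℕ.% n) _) ⟩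
      + (a ℕ.% n) ℤ.+ + ((a / n) * n) ℤ.- + (a ℕ.% n)
        ≡⟨ lem (+ (a ℕ.% n)) (+ ((a / n) * n)) ⟩
      + ((a / n) * n)
        ≡⟨ ℤ.pos-* (a / n) n ⟩
      + (a / n) ℤ.* + n ∎)))
    where
    open ≡-Reasoning
    lem : ∀ r q → r ℤ.+ q ℤ.- r ≡ q
    lem = solve-∀

  -- Signed labels may be negative, so reduction has to start from ℤ.
  residue : ℤ → Fin n
  residue i = fromℕ< (ℤ.n%ℕd<d i n)

  toℕ-residue : ∀ i → + toℕ (residue i) ≡ i [mod n ]
  toℕ-residue i rewrite toℕ-fromℕ< (ℤ.n%ℕd<d i n) = ≡mod.sym
    (congruent (ℤ∣.divides (i ℤ./ℕ n) (begin
      i ℤ.- + (i ℤ.%ℕ n)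
        ≡⟨ cong (ℤ._- (+ (i ℤ.%ℕ n))) (ℤ.a≡a%ℕn+[a/ℕn]*n i n) ⟩
      + (i ℤ.%ℕ n) ℤ.+ (i ℤ./ℕ n) ℤ.* + n ℤ.- + (i ℤ.%ℕ n)
        ≡⟨ lem (+ (i ℤ.%ℕ n)) ((i ℤ./ℕ n) ℤ.* + n) ⟩
      (i ℤ./ℕ n) ℤ.* + n ∎)))
    where
    open ≡-Reasoning
    lem : ∀ r q → r ℤ.+ q ℤ.- r ≡ q
    lem = solve-∀

  toℕ-⊖ : (x y : Fin n) → + toℕ (x ⊖ y) ≡ + toℕ x ℤ.- + toℕ y [mod n ]
  toℕ-⊖ x y = ≡mod.trans (toℕ-mod (toℕ x ℕ.+ (n ℕ.∸ toℕ y)))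
    -- The quotient 1 accounts for the single `n` that the definition of `_⊖_` adds to stay within
    -- ℕ.
    (congruent (ℤ∣.divides 1ℤ (begin
      + (toℕ x ℕ.+ (n ℕ.∸ toℕ y)) ℤ.- (+ toℕ x ℤ.- + toℕ y)
        ≡⟨ cong (ℤ._- (+ toℕ x ℤ.- + toℕ y)) (ℤ.pos-+ (toℕ x) _) ⟩
      + toℕ x ℤ.+ + (n ℕ.∸ toℕ y) ℤ.- (+ toℕ x ℤ.- + toℕ y)
        ≡⟨ cong (λ k → + toℕ x ℤ.+ k ℤ.- (+ toℕ x ℤ.- + toℕ y))
             (trans (sym (ℤ.⊖-≥ (toℕ≤n y))) (sym (ℤ.m-n≡m⊖n n (toℕ y)))) ⟩
      + toℕ x ℤ.+ (+ n ℤ.- + toℕ y) ℤ.- (+ toℕ x ℤ.- + toℕ y)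
        ≡⟨ lem (+ toℕ x) (+ toℕ y) (+ n) ⟩
      1ℤ ℤ.* + n ∎)))
    where
    open ≡-Reasoning
    lem : ∀ x y n → x ℤ.+ (n ℤ.- y) ℤ.- (x ℤ.- y) ≡ 1ℤ ℤ.* n
    lem = solve-∀

  module _ where
    open SetoidReasoning (≡mod-setoid n)

    -- The reflection s ↦ x - s is an involution; it exchanges the neighbours of `x` with the
    -- elements of the connection set.
    x⊖[x⊖y]≡y : (x y : Fin n) → x ⊖ (x ⊖ y) ≡ y
    x⊖[x⊖y]≡y x y = toℕ-≡mod-injective (begin
      + toℕ (x ⊖ (x ⊖ y))                    ≈⟨ toℕ-⊖ x (x ⊖ y) ⟩
      + toℕ x ℤ.- + toℕ (x ⊖ y)              ≡⟨ lem₁ (+ toℕ x) (+ toℕ (x ⊖ y)) ⟩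
      + toℕ x ℤ.+ -1ℤ ℤ.* + toℕ (x ⊖ y)
        ≈⟨ ≡mod-+-cong {i = + toℕ x} ≡mod.refl (≡mod-*-congˡ -1ℤ (toℕ-⊖ x y)) ⟩
      + toℕ x ℤ.+ -1ℤ ℤ.* (+ toℕ x ℤ.- + toℕ y)
        ≡⟨ lem₂ (+ toℕ x) (+ toℕ y) ⟩
      + toℕ y                                ∎)
      where
      lem₁ : ∀ x y → x ℤ.- y ≡ x ℤ.+ -1ℤ ℤ.* y
      lem₁ = solve-∀
      lem₂ : ∀ x y → x ℤ.+ -1ℤ ℤ.* (x ℤ.- y) ≡ y
      lem₂ = solve-∀

    ⊖-injectiveˡ : (y : Fin n) → Injective _≡_ _≡_ (_⊖ y)
    ⊖-injectiveˡ y {x} {x′} eq = toℕ-≡mod-injective (≡mod-+-cancelʳ (ℤ.- + toℕ y) (begin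
      + toℕ x ℤ.- + toℕ y    ≈⟨ toℕ-⊖ x y ⟨
      + toℕ (x ⊖ y)          ≡⟨ cong (λ z → + toℕ z) eq ⟩
      + toℕ (x′ ⊖ y)         ≈⟨ toℕ-⊖ x′ y ⟩
      + toℕ x′ ℤ.- + toℕ y   ∎))

  ⊖-injectiveʳ : (x : Fin n) → Injective _≡_ _≡_ (λ z → x ⊖ z)
  ⊖-injectiveʳ x {y} {y′} eq = trans (sym (x⊖[x⊖y]≡y x y)) (trans (cong (λ z → x ⊖ z) eq) (x⊖[x⊖y]≡y x y′))

  -- Weights in circulant graphs

  module _ (S : Subset n) (0∉S : 0ₙ ∉ S) (S=-S : NegationInvariant S) where
    open SetoidReasoning (≡mod-setoid n)

    -- Substitute y = x - s in the sum over all vertices: the adjacency test x - y ∈ S becomes s ∈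
    -- S.
    weight-Cay : (f : Fin n → Fin n) (x : Fin n) →
      + toℕ (weight (Cay S 0∉S S=-S) f x) ≡ sumOver S (λ s → + toℕ (f (x ⊖ s))) [mod n ]
    weight-Cay f x = begin
      + toℕ (weight (Cay S 0∉S S=-S) f x)  ≈⟨ toℕ-mod (sumℕ t) ⟩
      + sumℕ t                            ≡⟨ pos-sum t ⟩
      sum (λ y → + t y)                    ≡⟨ sum-reindex (⊖-injectiveʳ x) (λ y → + t y) ⟨
      sum (λ s → + t (x ⊖ s))              ≡⟨ sum-cong-≗ term ⟩
      sumOver S (λ s → + toℕ (f (x ⊖ s)))  ∎
      where
      t = λ y → if does (x ⊖ y ∈? S) then toℕ (f y) else 0

      pos-if : ∀ b a → + (if b then a else 0) ≡ 𝟙 b ℤ.* + a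
      pos-if true  a = sym (ℤ.*-identityˡ (+ a))
      pos-if false a = refl

      term : ∀ s → + t (x ⊖ s) ≡ 𝟙 (lookup S s) ℤ.* + toℕ (f (x ⊖ s))
      term s = trans (cong (λ z → + (if does (z ∈? S) then toℕ (f (x ⊖ s)) else 0)) (x⊖[x⊖y]≡y x s))
        (trans (cong (λ b → + (if b then toℕ (f (x ⊖ s)) else 0)) (does-∈? s S)) (pos-if (lookup S s) _))

    -- The common core of both sufficient conditions. The assumption that values determine signs is
    -- stated for all `k` and `c` because it serves twice: for the labels with (1, 0), and for the
    -- weights.
    twisted-antimagic : (ε : Fin n → ℤ) →
      (∀ x y → ε (x ⊖ y) ≡ ε x ℤ.* ε y) →
      (∀ x → ε x ℤ.* ε x ≡ 1ℤ) →
      (∀ k c → Coprime k (+ n) → ∀ x y →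
        ε x ℤ.* (k ℤ.* + toℕ x ℤ.- c) ≡ ε y ℤ.* (k ℤ.* + toℕ y ℤ.- c) [mod n ] → ε x ≡ ε y) →
      Coprime (sumOver S ε) (+ n) →
      ℤₙ-DistanceAntimagic (Cay S 0∉S S=-S)
    twisted-antimagic ε ε-⊖ ε²≡1 ε-determined k-coprime =
      f ,
      injective⇒bijective (affine-injective 1ℤ 0ℤ (λ (p , _) → ℕ.∣1⇒≡1 p) f-affine) ,
      affine-injective k c k-coprime weight-affine
      where
      f : Fin n → Fin n
      f x = residue (ε x ℤ.* + toℕ x)

      k = sumOver S ε
      c = sumOver S (λ s → ε s ℤ.* + toℕ s)

      Affine : ℤ → ℤ → (Fin n → Fin n) → Set
      Affine k c g = ∀ x → + toℕ (g x) ≡ ε x ℤ.* (k ℤ.* + toℕ x ℤ.- c) [mod n ]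

      -- Equal values have equal signs; multiplying by that sign, whose square is 1, leaves kx - c ≡
      -- ky - c, where `c` and then `k` cancel.
      affine-injective : ∀ k c → Coprime k (+ n) → ∀ {g} → Affine k c g → Injective _≡_ _≡_ g
      affine-injective k c coprime {g} g≈ {x} {y} gx≡gy =
        toℕ-≡mod-injective (≡mod-*-cancelˡ k coprime (≡mod-+-cancelʳ (ℤ.- c) (begin
          k ℤ.* + toℕ x ℤ.- c   ≡⟨ unsign x _ ⟨
          ε x ℤ.* (ε x ℤ.* (k ℤ.* + toℕ x ℤ.- c))
            ≈⟨ ≡mod-*-congˡ (ε x) same ⟩
          ε x ℤ.* (ε y ℤ.* (k ℤ.* + toℕ y ℤ.- c))
            ≡⟨ cong (ℤ._* (ε y ℤ.* (k ℤ.* + toℕ y ℤ.- c))) (ε-determined k c coprime x y same) ⟩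
          ε y ℤ.* (ε y ℤ.* (k ℤ.* + toℕ y ℤ.- c))
            ≡⟨ unsign y _ ⟩
          k ℤ.* + toℕ y ℤ.- c   ∎)))
        where
        same : ε x ℤ.* (k ℤ.* + toℕ x ℤ.- c) ≡ ε y ℤ.* (k ℤ.* + toℕ y ℤ.- c) [mod n ]
        same = begin
          ε x ℤ.* (k ℤ.* + toℕ x ℤ.- c)  ≈⟨ g≈ x ⟨
          + toℕ (g x)                    ≡⟨ cong (λ z → + toℕ z) gx≡gy ⟩
          + toℕ (g y)                    ≈⟨ g≈ y ⟩
          ε y ℤ.* (k ℤ.* + toℕ y ℤ.- c)  ∎

        unsign : ∀ x i → ε x ℤ.* (ε x ℤ.* i) ≡ i
        unsign x i = trans (sym (ℤ.*-assoc (ε x) (ε x) i))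
          (trans (cong (ℤ._* i) (ε²≡1 x)) (ℤ.*-identityˡ i))

      f-affine : Affine 1ℤ 0ℤ f
      f-affine x = begin
        + toℕ (f x)                          ≈⟨ toℕ-residue _ ⟩
        ε x ℤ.* + toℕ x                      ≡⟨ lem (ε x) (+ toℕ x) ⟩
        ε x ℤ.* (1ℤ ℤ.* + toℕ x ℤ.- 0ℤ)      ∎
        where
        lem : ∀ e x → e ℤ.* x ≡ e ℤ.* (1ℤ ℤ.* x ℤ.- 0ℤ)
        lem = solve-∀

      -- The label of x - s is ε(x)ε(s)(x - s) mod n. Expanding the product and summing over s
      -- separates `k`, multiplied by ε(x)x, from `c`, multiplied by -ε(x).
      weight-affine : Affine k c (weight (Cay S 0∉S S=-S) f)
      weight-affine x = begin
        + toℕ (weight (Cay S 0∉S S=-S) f x)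
          ≈⟨ weight-Cay f x ⟩
        sum (λ s → 𝟙 (lookup S s) ℤ.* + toℕ (f (x ⊖ s)))
          ≈⟨ ≡mod-sum (λ s → ≡mod-*-congˡ (𝟙 (lookup S s)) (f-⊖ s)) ⟩
        sum (λ s → 𝟙 (lookup S s) ℤ.* (ε x ℤ.* ε s ℤ.* (+ toℕ x ℤ.- + toℕ s)))
          ≡⟨ sum-cong-≗ (λ s → expand (𝟙 (lookup S s)) (ε x) (ε s) (+ toℕ x) (+ toℕ s)) ⟩
        sum (λ s → a ℤ.* K s ℤ.+ b ℤ.* C s)
          ≡⟨ ∑-distrib-+ (λ s → a ℤ.* K s) (λ s → b ℤ.* C s) ⟩
        sum (λ s → a ℤ.* K s) ℤ.+ sum (λ s → b ℤ.* C s)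
          ≡⟨ cong₂ ℤ._+_ (*-distribˡ-sum a K) (*-distribˡ-sum b C) ⟨
        a ℤ.* k ℤ.+ b ℤ.* c
          ≡⟨ collect (ε x) (+ toℕ x) k c ⟩
        ε x ℤ.* (k ℤ.* + toℕ x ℤ.- c) ∎
        where
        a = ε x ℤ.* + toℕ x
        b = ℤ.- ε x
        K = λ s → 𝟙 (lookup S s) ℤ.* ε s
        C = λ s → 𝟙 (lookup S s) ℤ.* (ε s ℤ.* + toℕ s)

        f-⊖ : ∀ s → + toℕ (f (x ⊖ s)) ≡ ε x ℤ.* ε s ℤ.* (+ toℕ x ℤ.- + toℕ s) [mod n ]
        f-⊖ s = begin
          + toℕ (f (x ⊖ s))                         ≈⟨ toℕ-residue _ ⟩
          ε (x ⊖ s) ℤ.* + toℕ (x ⊖ s)               ≈⟨ ≡mod-*-congˡ (ε (x ⊖ s)) (toℕ-⊖ x s) ⟩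
          ε (x ⊖ s) ℤ.* (+ toℕ x ℤ.- + toℕ s)       ≡⟨ cong (ℤ._* (+ toℕ x ℤ.- + toℕ s)) (ε-⊖ x s) ⟩
          ε x ℤ.* ε s ℤ.* (+ toℕ x ℤ.- + toℕ s)     ∎

        expand : ∀ χ e e′ x s → χ ℤ.* (e ℤ.* e′ ℤ.* (x ℤ.- s)) ≡
                 e ℤ.* x ℤ.* (χ ℤ.* e′) ℤ.+ ℤ.- e ℤ.* (χ ℤ.* (e′ ℤ.* s))
        expand = solve-∀

        collect : ∀ e x k c → e ℤ.* x ℤ.* k ℤ.+ ℤ.- e ℤ.* c ≡ e ℤ.* (k ℤ.* x ℤ.- c)
        collect = solve-∀

    -- Double counting: after exchanging the sums, each s in `S` contributes the labels f(x - s)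
    -- over all x, which are all residues once each.
    sum-weights : (f : Fin n → Fin n) → Injective _≡_ _≡_ f →
      sum (λ x → + toℕ (weight (Cay S 0∉S S=-S) f x)) ≡ + ∣ S ∣ ℤ.* sum {n} (λ x → + toℕ x) [mod n ]
    sum-weights f f-injective = begin
      sum (λ x → + toℕ (weight (Cay S 0∉S S=-S) f x))
        ≈⟨ ≡mod-sum (weight-Cay f) ⟩
      sum (λ x → sum (λ s → 𝟙 (lookup S s) ℤ.* + toℕ (f (x ⊖ s))))
        ≡⟨ ∑-comm (λ x s → 𝟙 (lookup S s) ℤ.* + toℕ (f (x ⊖ s))) ⟩
      sum (λ s → sum (λ x → 𝟙 (lookup S s) ℤ.* + toℕ (f (x ⊖ s))))
        ≡⟨ sum-cong-≗ inner ⟩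
      -- The factor 1 is kept so that pulling out `total` leaves literally a `sumOver` of the
      -- constant 1.
      sum (λ s → 𝟙 (lookup S s) ℤ.* 1ℤ ℤ.* total)
        ≡⟨ *-distribʳ-sum total (λ s → 𝟙 (lookup S s) ℤ.* 1ℤ) ⟨
      sumOver S (λ _ → 1ℤ) ℤ.* total
        ≡⟨ cong (ℤ._* total) (sumOver-1 S) ⟩
      + ∣ S ∣ ℤ.* total ∎
      where
      total = sum {n} (λ x → + toℕ x)

      inner : ∀ s → sum (λ x → 𝟙 (lookup S s) ℤ.* + toℕ (f (x ⊖ s))) ≡ 𝟙 (lookup S s) ℤ.* 1ℤ ℤ.* total
      inner s = trans (sym (*-distribˡ-sum (𝟙 (lookup S s)) (λ x → + toℕ (f (x ⊖ s)))))
        (cong₂ ℤ._*_ (sym (ℤ.*-identityʳ (𝟙 (lookup S s))))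
          (sum-reindex (⊖-injectiveˡ s ∘ f-injective) (λ x → + toℕ x)))

-- Gauss's formula, doubled to avoid halving.
sum-toℕ : ∀ n → + 2 ℤ.* sum {n} (λ x → + toℕ x) ≡ + n ℤ.* (+ n ℤ.- 1ℤ)
sum-toℕ ℕ.zero    = refl
sum-toℕ (ℕ.suc n) = begin
  + 2 ℤ.* (0ℤ ℤ.+ sum {n} (λ x → 1ℤ ℤ.+ + toℕ x))
    ≡⟨ cong (λ t → + 2 ℤ.* (0ℤ ℤ.+ t)) (∑-distrib-+ (λ _ → 1ℤ) (λ (x : Fin n) → + toℕ x)) ⟩
  + 2 ℤ.* (0ℤ ℤ.+ (sum {n} (λ _ → 1ℤ) ℤ.+ total))
    ≡⟨ cong (λ t → + 2 ℤ.* (0ℤ ℤ.+ (t ℤ.+ total))) (ones n) ⟩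
  + 2 ℤ.* (0ℤ ℤ.+ (+ n ℤ.+ total))
    ≡⟨ lem₁ (+ n) total ⟩
  + 2 ℤ.* + n ℤ.+ + 2 ℤ.* total
    ≡⟨ cong (λ t → + 2 ℤ.* + n ℤ.+ t) (sum-toℕ n) ⟩
  + 2 ℤ.* + n ℤ.+ + n ℤ.* (+ n ℤ.- 1ℤ)
    ≡⟨ lem₂ (+ n) ⟩
  (1ℤ ℤ.+ + n) ℤ.* (1ℤ ℤ.+ + n ℤ.- 1ℤ) ∎
  where
  open ≡-Reasoning
  total = sum {n} (λ x → + toℕ x)
  ones : ∀ n → sum {n} (λ _ → 1ℤ) ≡ + n
  ones ℕ.zero    = refl
  ones (ℕ.suc n) = cong (λ z → 1ℤ ℤ.+ z) (ones n)
  lem₁ : ∀ n t → + 2 ℤ.* (0ℤ ℤ.+ (n ℤ.+ t)) ≡ + 2 ℤ.* n ℤ.+ + 2 ℤ.* t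
  lem₁ = solve-∀
  lem₂ : ∀ n → + 2 ℤ.* n ℤ.+ n ℤ.* (n ℤ.- 1ℤ) ≡ (1ℤ ℤ.+ n) ℤ.* (1ℤ ℤ.+ n ℤ.- 1ℤ)
  lem₂ = solve-∀

-- The parity sign

sgn : ℕ → ℤ
sgn a = -1ℤ ℤ.^ a

sgn-+ : ∀ a b → sgn (a ℕ.+ b) ≡ sgn a ℤ.* sgn b
sgn-+ = ℤ.^-distribˡ-+-* -1ℤ

sgn-even : ∀ {a} → 2 ∣ a → sgn a ≡ 1ℤ
sgn-even (ℕ.divides q refl) = begin
  sgn (q * 2)      ≡⟨ cong sgn (ℕ.*-comm q 2) ⟩
  sgn (2 * q)      ≡⟨ ℤ.^-*-assoc -1ℤ 2 q ⟨
  1ℤ ℤ.^ q         ≡⟨ ℤ.^-zeroˡ q ⟩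
  1ℤ               ∎
  where open ≡-Reasoning

sgn² : ∀ a → sgn a ℤ.* sgn a ≡ 1ℤ
sgn² a = trans (sym (sgn-+ a a))
  (sgn-even (ℕ.divides a (trans (cong (a ℕ.+_) (sym (ℕ.+-identityʳ a))) (ℕ.*-comm 2 a))))

sgn-product-1⇒≡ : ∀ a b → sgn a ℤ.* sgn b ≡ 1ℤ → sgn a ≡ sgn b
sgn-product-1⇒≡ a b eq = begin
  sgn a                          ≡⟨ ℤ.*-identityʳ _ ⟨
  sgn a ℤ.* 1ℤ                   ≡⟨ cong (sgn a ℤ.*_) (sgn² b) ⟨
  sgn a ℤ.* (sgn b ℤ.* sgn b)    ≡⟨ ℤ.*-assoc (sgn a) (sgn b) (sgn b) ⟨
  sgn a ℤ.* sgn b ℤ.* sgn b      ≡⟨ cong (ℤ._* sgn b) eq ⟩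
  1ℤ ℤ.* sgn b                   ≡⟨ ℤ.*-identityˡ _ ⟩
  sgn b                          ∎
  where open ≡-Reasoning

-- a + b = (a - b) + 2b is even, so the two signs have product 1.
sgn-cong : ∀ {a b} → + a ≡ + b [mod 2 ] → sgn a ≡ sgn b
sgn-cong {a} {b} (congruent d) = sgn-product-1⇒≡ a b (trans (sym (sgn-+ a b)) (sgn-even
  (ℤ∣.∣⇒∣ᵤ (subst (+ 2 ℤ∣.∣_) (trans (lem (+ a) (+ b)) (sym (ℤ.pos-+ a b)))
    (ℤ∣.∣m∣n⇒∣m+n d (ℤ∣.∣m⇒∣m*n (+ b) (ℤ∣.∣-refl {+ 2})))))))
  where
  lem : ∀ a b → a ℤ.- b ℤ.+ + 2 ℤ.* b ≡ a ℤ.+ b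
  lem = solve-∀

sgn≡1[mod2] : ∀ a → sgn a ≡ 1ℤ [mod 2 ]
sgn≡1[mod2] ℕ.zero    = ≡mod.refl
sgn≡1[mod2] (ℕ.suc a) = ≡mod.trans (≡mod-*-congˡ -1ℤ (sgn≡1[mod2] a)) (congruent (ℤ∣.divides -1ℤ refl))

-- Phrased through the decision procedure to match the definition of `evens`.
sgn-dec : ∀ {a} (2∣a? : Dec (2 ∣ a)) → sgn a ≡ (if does 2∣a? then 1ℤ else -1ℤ)
sgn-dec     (yes 2∣a) = sgn-even 2∣a
-- For odd `a` the successor is even, so -1 times the sign of `a` is 1 = (-1)(-1), and -1 cancels.
sgn-dec {a} (no ¬2∣a) = ℤ.*-cancelˡ-≡ -1ℤ (sgn a) -1ℤ
  (sgn-even {ℕ.suc a} (suc-even (a ℕ.% 2) (a / 2) (ℕ.m≡m%n+[m/n]*n a 2) (ℕ.m%n<n a 2)))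
  where
  suc-even : ∀ r q → a ≡ r ℕ.+ q * 2 → r ℕ.< 2 → 2 ∣ ℕ.suc a
  suc-even 0 q eq _ = ⊥-elim (¬2∣a (ℕ.divides q eq))
  suc-even 1 q eq _ = ℕ.divides (ℕ.suc q) (cong ℕ.suc eq)
  suc-even (ℕ.suc (ℕ.suc _)) _ _ (ℕ.s≤s (ℕ.s≤s ()))

-- Pointwise, the sign is the indicator of the evens minus that of the odds; `split` checks this on
-- Booleans.
sumOver-sgn : (T : Subset n) → sumOver T (sgn ∘ toℕ) ≡ + ∣ T ∩ evens ∣ ℤ.- + ∣ T ∩ odds ∣
sumOver-sgn T = begin
  sumOver T (sgn ∘ toℕ)
    ≡⟨ sum-cong-≗ term ⟩
  sum (λ i → E i ℤ.+ -1ℤ ℤ.* O i)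
    ≡⟨ ∑-distrib-+ E (λ i → -1ℤ ℤ.* O i) ⟩
  sum E ℤ.+ sum (λ i → -1ℤ ℤ.* O i)
    ≡⟨ cong (λ z → sum E ℤ.+ z) (*-distribˡ-sum -1ℤ O) ⟨
  sum E ℤ.+ -1ℤ ℤ.* sum O
    ≡⟨ cong₂ (λ e o → e ℤ.+ -1ℤ ℤ.* o) (sumOver-1 (T ∩ evens)) (sumOver-1 (T ∩ odds)) ⟩
  + ∣ T ∩ evens ∣ ℤ.+ -1ℤ ℤ.* + ∣ T ∩ odds ∣
    ≡⟨ cong (λ z → + ∣ T ∩ evens ∣ ℤ.+ z) (ℤ.-1*i≡-i (+ ∣ T ∩ odds ∣)) ⟩
  + ∣ T ∩ evens ∣ ℤ.- + ∣ T ∩ odds ∣ ∎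
  where
  open ≡-Reasoning
  E = λ i → 𝟙 (lookup (T ∩ evens) i) ℤ.* 1ℤ
  O = λ i → 𝟙 (lookup (T ∩ odds) i) ℤ.* 1ℤ

  split : ∀ t e → 𝟙 t ℤ.* (if e then 1ℤ else -1ℤ) ≡ 𝟙 (t ∧ e) ℤ.* 1ℤ ℤ.+ -1ℤ ℤ.* (𝟙 (t ∧ not e) ℤ.* 1ℤ)
  split false false = refl
  split false true  = refl
  split true  false = refl
  split true  true  = refl

  term : ∀ i → 𝟙 (lookup T i) ℤ.* sgn (toℕ i) ≡ E i ℤ.+ -1ℤ ℤ.* O i
  term i rewrite lookup-zipWith _∧_ i T evens | lookup-zipWith _∧_ i T odds
               | lookup-map i not evens | lookup∘tabulate (λ x → does (2 ℕ.∣? toℕ x)) i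
               | sgn-dec (2 ℕ.∣? toℕ i) = split (lookup T i) (does (2 ℕ.∣? toℕ i))

module _ {n : ℕ} .{{_ : NonZero n}} (2∣n : 2 ∣ n) where

  -- Reduction modulo an even `n` preserves parity, and x - y has the parity of x + y.
  sgn-⊖ : (x y : Fin n) → sgn (toℕ (x ⊖ y)) ≡ sgn (toℕ x) ℤ.* sgn (toℕ y)
  sgn-⊖ x y = trans (sgn-cong (begin
    + toℕ (x ⊖ y)                 ≈⟨ ≡mod-∣ 2∣n (toℕ-⊖ x y) ⟩
    + toℕ x ℤ.- + toℕ y           ≈⟨ congruent (ℤ∣.divides (ℤ.- + toℕ y) (lem (+ toℕ x) (+ toℕ y))) ⟩
    + toℕ x ℤ.+ + toℕ y           ≡⟨ ℤ.pos-+ (toℕ x) (toℕ y) ⟨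
    + (toℕ x ℕ.+ toℕ y)           ∎)) (sgn-+ (toℕ x) (toℕ y))
    where
    open SetoidReasoning (≡mod-setoid 2)
    lem : ∀ x y → x ℤ.- y ℤ.- (x ℤ.+ y) ≡ ℤ.- y ℤ.* + 2
    lem = solve-∀

  -- Signs are 1 mod 2 and k is odd, so the parity of x can be read off the value.
  sgn-determined : ∀ k c → Coprime k (+ n) → (x y : Fin n) →
    sgn (toℕ x) ℤ.* (k ℤ.* + toℕ x ℤ.- c) ≡ sgn (toℕ y) ℤ.* (k ℤ.* + toℕ y ℤ.- c) [mod n ] →
    sgn (toℕ x) ≡ sgn (toℕ y)
  sgn-determined k c coprime x y eq = sgn-cong (≡mod-*-cancelˡ k (λ (p , q) → coprime (p , ℕ.∣-trans q 2∣n))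
    (≡mod-+-cancelʳ (ℤ.- c) (begin
      i                          ≈⟨ drop-sgn (toℕ x) i ⟨
      sgn (toℕ x) ℤ.* i          ≈⟨ ≡mod-∣ 2∣n eq ⟩
      sgn (toℕ y) ℤ.* j          ≈⟨ drop-sgn (toℕ y) j ⟩
      j                          ∎)))
    where
    open SetoidReasoning (≡mod-setoid 2)
    i = k ℤ.* + toℕ x ℤ.- c
    j = k ℤ.* + toℕ y ℤ.- c
    drop-sgn : ∀ a i → sgn a ℤ.* i ≡ i [mod 2 ]
    drop-sgn a i = begin
      sgn a ℤ.* i   ≡⟨ ℤ.*-comm (sgn a) i ⟩
      i ℤ.* sgn a   ≈⟨ ≡mod-*-congˡ i (sgn≡1[mod2] a) ⟩
      i ℤ.* 1ℤ      ≡⟨ ℤ.*-identityʳ i ⟩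
      i             ∎

-- The two sufficient conditions and the parity obstruction

module _ {n : ℕ} .{{_ : NonZero n}} (S : Subset n) (0∉S : 0ₙ ∉ S) (S=-S : NegationInvariant S) where

  -- Here k = ε(p) + 2s - 2t, which is 2(s - t) + 1 for even `p` and -(2(t - s) + 1) for odd `p`;
  -- each coprimality assumption settles one parity.
  antimagic-parity : 2 ∣ n → ∀ {p} → p ∈ S → ∀ s t →
    ∣ (S - p) ∩ evens ∣ ≡ 2 * s → ∣ (S - p) ∩ odds ∣ ≡ 2 * t →
    Coprime (+ 2 ℤ.* (+ s ℤ.- + t) ℤ.+ + 1) (+ n) →
    Coprime (+ 2 ℤ.* (+ t ℤ.- + s) ℤ.+ + 1) (+ n) →
    ℤₙ-DistanceAntimagic (Cay S 0∉S S=-S)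
  antimagic-parity 2∣n {p} p∈S s t evens≡2s odds≡2t coprime₁ coprime₂ =
    twisted-antimagic S 0∉S S=-S (sgn ∘ toℕ) (sgn-⊖ 2∣n) (sgn² ∘ toℕ) (sgn-determined 2∣n) k-coprime
    where
    open ≡-Reasoning

    k≡ : sumOver S (sgn ∘ toℕ) ≡ sgn (toℕ p) ℤ.+ (+ 2 ℤ.* + s ℤ.- + 2 ℤ.* + t)
    k≡ = begin
      sumOver S (sgn ∘ toℕ)
        ≡⟨ sumOver-remove p∈S (sgn ∘ toℕ) ⟩
      sgn (toℕ p) ℤ.+ sumOver (S - p) (sgn ∘ toℕ)
        ≡⟨ cong (λ z → sgn (toℕ p) ℤ.+ z) (sumOver-sgn (S - p)) ⟩
      sgn (toℕ p) ℤ.+ (+ ∣ (S - p) ∩ evens ∣ ℤ.- + ∣ (S - p) ∩ odds ∣)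
        ≡⟨ cong₂ (λ a b → sgn (toℕ p) ℤ.+ (a ℤ.- b))
             (trans (cong +_ evens≡2s) (ℤ.pos-* 2 s)) (trans (cong +_ odds≡2t) (ℤ.pos-* 2 t)) ⟩
      sgn (toℕ p) ℤ.+ (+ 2 ℤ.* + s ℤ.- + 2 ℤ.* + t) ∎

    lem₁ : ∀ s t → 1ℤ ℤ.+ (+ 2 ℤ.* s ℤ.- + 2 ℤ.* t) ≡ + 2 ℤ.* (s ℤ.- t) ℤ.+ + 1
    lem₁ = solve-∀
    lem₂ : ∀ s t → -1ℤ ℤ.+ (+ 2 ℤ.* s ℤ.- + 2 ℤ.* t) ≡ ℤ.- (+ 2 ℤ.* (t ℤ.- s) ℤ.+ + 1)
    lem₂ = solve-∀

    k-coprime : Coprime (sumOver S (sgn ∘ toℕ)) (+ n)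
    k-coprime rewrite k≡ | sgn-dec (2 ℕ.∣? toℕ p) with does (2 ℕ.∣? toℕ p)
    ... | true  rewrite lem₁ (+ s) (+ t) = coprime₁
    ... | false rewrite lem₂ (+ s) (+ t) | ℤ.∣-i∣≡∣i∣ (+ 2 ℤ.* (+ t ℤ.- + s) ℤ.+ + 1) = coprime₂

  -- With constant sign 1 the labelling is the identity, the sign conditions hold by computation,
  -- and k = |S|.
  antimagic-coprime : gcd ∣ S ∣ n ≡ 1 → ℤₙ-DistanceAntimagic (Cay S 0∉S S=-S)
  antimagic-coprime gcd≡1 =
    twisted-antimagic S 0∉S S=-S (λ _ → 1ℤ) (λ _ _ → refl) (λ _ → refl) (λ _ _ _ _ _ _ → refl)
      (subst (λ k → Coprime k (+ n)) (sym (sumOver-1 S)) (gcd≡1⇒coprime gcd≡1))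

  not-antimagic-even : 2 ∣ ∣ S ∣ → 2 ∣ n → ¬ ℤₙ-DistanceAntimagic (Cay S 0∉S S=-S)
  not-antimagic-even (ℕ.divides a ∣S∣≡a*2) (ℕ.divides h n≡h*2) (f , (f-injective , _) , w-injective) =
    -- Injective weights run through every residue once, so their sum is exactly `total`.
    absurd (≡mod.trans (≡mod-reflexive (sym (sum-reindex w-injective (λ x → + toℕ x))))
                       (sum-weights S 0∉S S=-S f f-injective))
    where
    open ≡-Reasoning
    total = sum {n} (λ x → + toℕ x)
    σ = + ∣ S ∣
    N = + n
    A = + a
    H = + h

    absurd : ¬ total ≡ σ ℤ.* total [mod n ]
    absurd (congruent (ℤ∣.divides q eq)) = 2≢1 (ℕ.∣1⇒≡1 (ℤ∣.∣⇒∣ᵤ (ℤ∣.divides {+ 2} {1ℤ} (r ℤ.- q) (begin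
      1ℤ
        ≡⟨ lem₂ A H ⟩
      r ℤ.* + 2 ℤ.- (H ℤ.* + 2 ℤ.- 1ℤ) ℤ.* (1ℤ ℤ.- A ℤ.* + 2)
        ≡⟨ cong₂ (λ x y → r ℤ.* + 2 ℤ.- (x ℤ.- 1ℤ) ℤ.* (1ℤ ℤ.- y))
             (trans (cong +_ n≡h*2) (ℤ.pos-* h 2)) (trans (cong +_ ∣S∣≡a*2) (ℤ.pos-* a 2)) ⟨
      r ℤ.* + 2 ℤ.- (N ℤ.- 1ℤ) ℤ.* (1ℤ ℤ.- σ)
        ≡⟨ cong (λ x → r ℤ.* + 2 ℤ.- x) cancelled ⟩
      r ℤ.* + 2 ℤ.- q ℤ.* + 2
        ≡⟨ lem₃ r q ⟩
      (r ℤ.- q) ℤ.* + 2 ∎))))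
      where
      -- Chosen so that (n - 1)(1 - |S|) = 2r - 1 when n = 2h and |S| = 2a.
      r = H ℤ.+ A ℤ.- + 2 ℤ.* A ℤ.* H
      2≢1 : ¬ 2 ≡ 1
      2≢1 ()
      lem₁ : ∀ σ t → + 2 ℤ.* t ℤ.* (1ℤ ℤ.- σ) ≡ + 2 ℤ.* (t ℤ.- σ ℤ.* t)
      lem₁ = solve-∀
      lem₂ : ∀ a h → 1ℤ ≡ (h ℤ.+ a ℤ.- + 2 ℤ.* a ℤ.* h) ℤ.* + 2 ℤ.- (h ℤ.* + 2 ℤ.- 1ℤ) ℤ.* (1ℤ ℤ.- a ℤ.* + 2)
      lem₂ = solve-∀
      lem₃ : ∀ x q → x ℤ.* + 2 ℤ.- q ℤ.* + 2 ≡ (x ℤ.- q) ℤ.* + 2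
      lem₃ = solve-∀
      lem₄ : ∀ n q → + 2 ℤ.* (q ℤ.* n) ≡ n ℤ.* (q ℤ.* + 2)
      lem₄ = solve-∀

      -- Doubling total - |S| total = qn turns its left side into n(n - 1)(1 - |S|), and the nonzero
      -- factor n cancels; an odd number is then equal to 2q.
      cancelled : (N ℤ.- 1ℤ) ℤ.* (1ℤ ℤ.- σ) ≡ q ℤ.* + 2
      cancelled = ℤ.*-cancelˡ-≡ N _ _ (begin
        N ℤ.* ((N ℤ.- 1ℤ) ℤ.* (1ℤ ℤ.- σ))   ≡⟨ ℤ.*-assoc N (N ℤ.- 1ℤ) (1ℤ ℤ.- σ) ⟨
        N ℤ.* (N ℤ.- 1ℤ) ℤ.* (1ℤ ℤ.- σ)     ≡⟨ cong (ℤ._* (1ℤ ℤ.- σ)) (sum-toℕ n) ⟨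
        + 2 ℤ.* total ℤ.* (1ℤ ℤ.- σ)        ≡⟨ lem₁ σ total ⟩
        + 2 ℤ.* (total ℤ.- σ ℤ.* total)     ≡⟨ cong ((+ 2) ℤ.*_) eq ⟩
        + 2 ℤ.* (q ℤ.* N)                   ≡⟨ lem₄ N q ⟩
        N ℤ.* (q ℤ.* + 2)                   ∎)

mainTheorem19 : ∀ (n : ℕ) .{{_ : NonZero n}} → n ≥ 3 →
    (S : Subset n) (0∉S : 0ₙ ∉ S) (S=-S : NegationInvariant S) →
    let n/2 = (n / 2) mod n in
    ( ( ( 2 ∣ n × n/2 ∈ S ×
    ∃₂ λ (s t : ℕ) →
    ∣ (S - n/2) ∩ evens ∣ ≡ 2 * s ×
    ∣ (S - n/2) ∩ odds ∣ ≡ 2 * t ×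
    Coprime (+ 2 ℤ.* (+ s ℤ.- + t) ℤ.+ + 1) (+ n) ×
    Coprime (+ 2 ℤ.* (+ t ℤ.- + s) ℤ.+ + 1) (+ n) )
    ⊎ gcd ∣ S ∣ n ≡ 1 )
    → ℤₙ-DistanceAntimagic (Cay S 0∉S S=-S) )
    × ( 2 ∣ ∣ S ∣ → 2 ∣ n → ¬ ℤₙ-DistanceAntimagic (Cay S 0∉S S=-S) )
mainTheorem19 n n≥3 S 0∉S S=-S =
  [ (λ (2∣n , n/2∈S , s , t , evens≡2s , odds≡2t , coprime₁ , coprime₂) →
      antimagic-parity S 0∉S S=-S 2∣n n/2∈S s t evens≡2s odds≡2t coprime₁ coprime₂)
  , antimagic-coprime S 0∉S S=-S ]′
  , not-antimagic-even S 0∉S S=-S
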